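{- Let $P_n$ denote the path on $n$ vertices. For every $n \ge 1$, $$\iota_{\rm g}(P_n)=\begin{cases}\left\lfloor\frac{2n+1}{5}\right\rfloor-1, & \text{if } n\equiv 0 \pmod 5,\\[2pt] \left\lfloor\frac{2n+1}{5}\right\rfloor, & \text{otherwise},\end{cases}$$ and $$\iota_{\rm g}'(P_n)=\left\lfloor\frac{2n+2}{5}\right\rfloor.$$
   Context: For a graph $G$ and $X\subseteq V(G)$, $N_G[X]$ denotes the set of vertices in $X$ or adjacent to a vertex of $X$. The isolation game on a finite graph $G$ is played by two players, Dominator and Staller, who alternately select vertices of $G$. If $X$ is the set of vertices selected so far, a vertex $x$ may be selected (is playable) only if $x$ dominates (i.e., equals or is adjacent to) some vertex belonging to a component of $G - N_G[X]$ with at least two vertices. The game ends when no playable vertex exists. Dominator aims to minimize the total number of selected vertices, Staller aims to maximize it. The game isolation number $\iota_{\rm g}(G)$ is the number of vertices selected when Dominator makes the first move and both play optimally; $\iota_{\rm g}'(G)$ is the same quantity when Staller makes the first move. -}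

module Defs where

open import Data.Nat using (ℕ; zero; suc; _⊓_; _⊔_) renaming (_≡ᵇ_ to _≡ℕᵇ_)
open import Data.Fin using (Fin; toℕ; _≟_)
open import Data.Bool using (Bool; true; false; _∧_; _∨_; not)
open import Data.Bool.Properties using (∨-comm)
open import Data.List using (List; []; _∷_; allFin; filterᵇ; map; foldr)
open import Data.Bool.ListAction using (any)
open import Relation.Nullary.Decidable using (⌊_⌋)
open import Relation.Binary.PropositionalEquality using (_≡_; refl)

record Graph (n : ℕ) : Set where
  field
    adj        : Fin n → Fin n → Bool
    adj-sym    : ∀ i j → adj i j ≡ adj j i
    adj-irrefl : ∀ i → adj i i ≡ false
open Graph public

VSet : ℕ → Set
VSet n = Fin n → Bool

∅ : ∀ {n} → VSet n
∅ _ = false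

_==_ : ∀ {n} → Fin n → Fin n → Bool
i == j = ⌊ i ≟ j ⌋

insert : ∀ {n} → Fin n → VSet n → VSet n
insert x X v = X v ∨ (x == v)

module _ {n : ℕ} (G : Graph n) where

  verts : List (Fin n)
  verts = allFin n

  dominates : Fin n → Fin n → Bool
  dominates x v = (x == v) ∨ adj G x v

  inClosedNbhd : VSet n → Fin n → Bool
  inClosedNbhd X v = any (λ x → X x ∧ dominates x v) verts

  alive : VSet n → Fin n → Bool
  alive X v = not (inClosedNbhd X v)

  reachWithin : VSet n → ℕ → Fin n → Fin n → Bool
  reachWithin X zero    v w = alive X v ∧ (v == w)
  reachWithin X (suc k) v w =
    reachWithin X k v w ∨
    any (λ u → reachWithin X k v u ∧ (alive X w ∧ adj G u w)) verts

  -- w lies in the component of v in G - N_G[X]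
  -- (walks of length ≤ n suffice, since there are n vertices)
  sameComponent : VSet n → Fin n → Fin n → Bool
  sameComponent X v w = reachWithin X n v w

  inBigComponent : VSet n → Fin n → Bool
  inBigComponent X v = any (λ w → not (v == w) ∧ sameComponent X v w) verts

  playable : VSet n → Fin n → Bool
  playable X x = any (λ v → dominates x v ∧ inBigComponent X v) verts

  data Player : Set where
    dominator staller : Player

  other : Player → Player
  other dominator = staller
  other staller   = dominator

  optimum : Player → ℕ → List ℕ → ℕ
  optimum dominator a as = foldr _⊓_ a as
  optimum staller   a as = foldr _⊔_ a as

  -- Number of vertices still to be selected from position X, player p to
  -- move, under optimal play (Dominator minimises, Staller maximises).
  -- The fuel argument bounds the number of remaining moves; every move
  -- selects a new vertex (a selected vertex is never playable), so fuel n
  -- from the empty position is never exhausted.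
  value : ℕ → Player → VSet n → ℕ
  value zero     p X = 0
  value (suc f) p X with filterᵇ (playable X) verts
  ... | []     = 0
  ... | x ∷ xs = suc (optimum p (next x) (map next xs))
    where
      next : Fin n → ℕ
      next y = value f (other p) (insert y X)

  ιg : ℕ
  ιg = value n dominator ∅

  ιg′ : ℕ
  ιg′ = value n staller ∅

private
  suc≢ᵇ : ∀ m → (suc m ≡ℕᵇ m) ≡ false
  suc≢ᵇ zero    = refl
  suc≢ᵇ (suc m) = suc≢ᵇ m

pathAdj : ∀ {n} → Fin n → Fin n → Bool
pathAdj i j = (suc (toℕ i) ≡ℕᵇ toℕ j) ∨ (suc (toℕ j) ≡ℕᵇ toℕ i)

P : (n : ℕ) → Graph n
P n = record
  { adj        = pathAdj
  ; adj-sym    = λ i j → ∨-comm (suc (toℕ i) ≡ℕᵇ toℕ j) (suc (toℕ j) ≡ℕᵇ toℕ i)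
  ; adj-irrefl = λ i → irr i
  }
  where
    irr : ∀ i → pathAdj {n} i i ≡ false
    irr i rewrite suc≢ᵇ (toℕ i) = refl

{-# OPTIONS --safe #-}
module Submission where

-- Index the edges of the path by consecutive cells. Selecting a vertex kills a window of four
-- consecutive cells, and the move is legal iff one of them is alive, so the game is played on a row
-- of cells. Let E be the number of live edges and C the number of components containing one.
--
-- Upper bounds. Put W = 2E + 4C. Every move lowers W by at least 2, and as long as some component
-- has at least three vertices Dominator can lower it by 8, so at most (W - 1)/5 moves remain when
-- Dominator is to move and at most (W + 2)/5 when Staller is. When every component is a single edge,
-- exactly E moves remain.
--
-- Lower bounds. Once a vertex has been selected, Staller can always kill exactly one edge, next to
-- an interval of dead cells, whereas Dominator kills at most four.
--
-- On the untouched path with n ≥ 3 no move kills a single edge, so Staller's first move kills at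
-- least two. Two residues mod 5 need more: for n ≡ 0 Dominator keeps a single component, with E ≡ 4
-- whenever he is to move, and for n ≡ 2 Staller first cuts off a component with one edge, which
-- later costs a move of its own.

open import Defs
open import Data.Bool using (Bool; true; false; _∧_; _∨_; not)
open import Data.Bool.ListAction using (any)
open import Data.Bool.Properties using (∧-zeroʳ; ∧-identityʳ; ∧-conicalˡ; ∧-conicalʳ; ∨-zeroʳ; ⇔→≡; T-≡)
open import Data.Empty using (⊥-elim)
open import Data.Fin using (Fin; zero; suc; toℕ; fromℕ<; _≟_)
open import Data.Fin.Properties using (toℕ<n; toℕ-injective; toℕ-fromℕ<)
open import Data.List using ([]; _∷_; allFin; map; foldr; filterᵇ)
open import Data.List.Membership.Propositional using (_∈_; lose; find)
open import Data.List.Membership.Propositional.Properties using (∈-allFin; ∈-filter⁺; ∈-filter⁻; ∈-map⁺; ∈-map⁻; foldr-selective)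
open import Data.List.Relation.Unary.Any using (here; there)
open import Data.List.Relation.Unary.Any.Properties using (any⁺; any⁻)
open import Data.Nat using (ℕ; zero; suc; _≥_; _+_; _*_; _∸_; _/_; _%_; _≤_; _<_; z≤n; s≤s; _≡ᵇ_; _<ᵇ_; _⊓_; _⊔_)
open import Data.Nat.DivMod using (/-monoˡ-≤; m*n/n≡m; +-distrib-/-∣ʳ; m≡m%n+[m/n]*n; m%n<n)
open import Data.Nat.Divisibility using (n∣m*n)
open import Data.Nat.Properties hiding (_≟_)
open import Data.Nat.Tactic.RingSolver using (solve; solve-∀)
open import Data.Product using (_×_; _,_; ∃-syntax; proj₂)
open import Data.Sum using (_⊎_; inj₁; inj₂; [_,_]′)
open import Function using (_∘_; Equivalence; mk⇔)
open import Relation.Binary.PropositionalEquality using (_≡_; _≢_; refl; sym; trans; cong; cong₂; subst)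
open import Relation.Nullary using (yes; no)
open import Relation.Nullary.Decidable using (T?)

-- Rows of cells

Row : Set
Row = ℕ → Bool

bit : Bool → ℕ
bit false = 0
bit true  = 1

count : Row → ℕ → ℕ
count f zero    = 0
count f (suc N) = bit (f 0) + count (f ∘ suc) N

-- A run is counted at its first cell; `p` is the state of the cell before the row, so that the
-- count continues after a shift.
runs : Bool → Row → ℕ → ℕ
runs p f zero    = 0
runs p f (suc N) = bit (f 0 ∧ not p) + runs (f 0) (f ∘ suc) N

-- Recursion on `y` makes shifting a row turn `window (suc y)` into `window y` by definition.
window : ℕ → Row
window zero    i       = i <ᵇ 4
window (suc y) zero    = false
window (suc y) (suc i) = window y i

hit : Row → ℕ → ℕ
hit f y = bit (f y) + bit (f (1 + y)) + bit (f (2 + y)) + bit (f (3 + y))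

prev : Bool → Row → ℕ → Bool
prev p f zero    = p
prev p f (suc y) = prev (f 0) (f ∘ suc) y

-- Run starts in the four cells of a window and in the cell `e` after it, the only places where
-- killing the window can change them.
starts : Bool → (a b c d e : Bool) → ℕ
starts p a b c d e = bit (a ∧ not p) + bit (b ∧ not a) + bit (c ∧ not b) + bit (d ∧ not c) + bit (e ∧ not d)

startsAt : Bool → Row → ℕ → ℕ
startsAt p f y = starts (prev p f y) (f y) (f (1 + y)) (f (2 + y)) (f (3 + y)) (f (4 + y))

Kill : ℕ → Row → Row → Set
Kill y f g = ∀ i → g i ≡ f i ∧ not (window y i)

infixr 6 _⊹_
infixr 7 _⊙_

_⊹_ : ∀ {a b c d} → a ≤ b → c ≤ d → a + c ≤ b + d
_⊹_ = +-mono-≤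

_⊙_ : ∀ k {a b} → a ≤ b → k * a ≤ k * b
k ⊙ a≤b = *-monoʳ-≤ k a≤b

-- Hypotheses enter through c ≤ d, so every linear inequality reduces to a ring identity.
linear : ∀ {a b c d} s → c ≤ d → b + c ≡ a + d + s → a ≤ b
linear {a} {b} {c} {d} s c≤d eq = +-cancelʳ-≤ c a b (begin
  a + c     ≤⟨ +-monoʳ-≤ a c≤d ⟩
  a + d     ≤⟨ m≤m+n (a + d) s ⟩
  a + d + s ≡⟨ sym eq ⟩
  b + c     ∎)
  where open ≤-Reasoning

count-cong : ∀ {f g} N → (∀ i → f i ≡ g i) → count f N ≡ count g N
count-cong zero    f≗g = refl
count-cong (suc N) f≗g = cong₂ _+_ (cong bit (f≗g 0)) (count-cong N (f≗g ∘ suc))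

runs-cong : ∀ {p q f g} N → p ≡ q → (∀ i → f i ≡ g i) → runs p f N ≡ runs q g N
runs-cong zero    p≡q f≗g = refl
runs-cong (suc N) refl f≗g =
  cong₂ _+_ (cong (λ b → bit (b ∧ _)) (f≗g 0)) (runs-cong N (f≗g 0) (f≗g ∘ suc))

Kill-outside : ∀ {y f g i} → Kill y f g → window y i ≡ false → g i ≡ f i
Kill-outside {f = f} {i = i} k out = trans (k i) (trans (cong (λ b → f i ∧ not b) out) (∧-identityʳ (f i)))

Kill-inside : ∀ {y f g i} → Kill y f g → window y i ≡ true → g i ≡ false
Kill-inside {f = f} {i = i} k inn = trans (k i) (trans (cong (λ b → f i ∧ not b) inn) (∧-zeroʳ (f i)))

count-kill : ∀ {f g} y N → Kill y f g → 4 + y ≤ N → count f N ≡ count g N + hit f y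
count-kill {f} {g} zero (suc (suc (suc (suc N)))) k le
  rewrite Kill-inside {zero} {f} {g} {0} k refl | Kill-inside {zero} {f} {g} {1} k refl
        | Kill-inside {zero} {f} {g} {2} k refl | Kill-inside {zero} {f} {g} {3} k refl
        | count-cong {λ i → g (4 + i)} {λ i → f (4 + i)} N (λ i → Kill-outside {0} {f} {g} {4 + i} k refl)
  = lemma (bit (f 0)) (bit (f 1)) (bit (f 2)) (bit (f 3)) (count (λ i → f (4 + i)) N)
  where
  lemma : ∀ a b c d s → a + (b + (c + (d + s))) ≡ s + (a + b + c + d)
  lemma = solve-∀
count-kill zero zero k ()
count-kill zero (suc zero) k (s≤s ())
count-kill zero (suc (suc zero)) k (s≤s (s≤s ()))
count-kill zero (suc (suc (suc zero))) k (s≤s (s≤s (s≤s ())))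
count-kill {f} {g} (suc y) (suc N) k (s≤s le)
  rewrite Kill-outside {suc y} {f} {g} {0} k refl
        | count-kill {f ∘ suc} {g ∘ suc} y N (k ∘ suc) le
  = sym (+-assoc (bit (f 0)) _ _)

-- After the kill no cell of the window starts a run, and the next cell, whose predecessor is now
-- dead, starts one exactly when it is live. The two-sided sum avoids subtraction.
runs-kill : ∀ {f g} p y N → Kill y f g → 5 + y ≤ N →
            runs p f N + bit (f (4 + y)) ≡ runs p g N + startsAt p f y
runs-kill {f} {g} p zero (suc (suc (suc (suc (suc N))))) k le
  rewrite Kill-inside {zero} {f} {g} {0} k refl | Kill-inside {zero} {f} {g} {1} k refl
        | Kill-inside {zero} {f} {g} {2} k refl | Kill-inside {zero} {f} {g} {3} k refl
        | Kill-outside {zero} {f} {g} {4} k refl | ∧-identityʳ (f 4)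
        | runs-cong {f 4} {f 4} {λ i → g (5 + i)} {λ i → f (5 + i)} N refl (λ i → Kill-outside {0} {f} {g} {5 + i} k refl)
  = lemma (bit (f 0 ∧ not p)) (bit (f 1 ∧ not (f 0))) (bit (f 2 ∧ not (f 1))) (bit (f 3 ∧ not (f 2)))
          (bit (f 4 ∧ not (f 3))) (runs (f 4) (λ i → f (5 + i)) N) (bit (f 4))
  where
  lemma : ∀ a b c d e s r → a + (b + (c + (d + (e + s)))) + r ≡ r + s + (a + b + c + d + e)
  lemma = solve-∀
runs-kill p zero zero k ()
runs-kill p zero (suc zero) k (s≤s ())
runs-kill p zero (suc (suc zero)) k (s≤s (s≤s ()))
runs-kill p zero (suc (suc (suc zero))) k (s≤s (s≤s (s≤s ())))
runs-kill p zero (suc (suc (suc (suc zero)))) k (s≤s (s≤s (s≤s (s≤s ()))))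
runs-kill {f} {g} p (suc y) (suc N) k (s≤s le)
  rewrite Kill-outside {suc y} {f} {g} {0} k refl =
  trans (+-assoc (bit (f 0 ∧ not p)) _ _)
    (trans (cong (bit (f 0 ∧ not p) +_) (runs-kill {f ∘ suc} {g ∘ suc} (f 0) y N (k ∘ suc) le))
      (sym (+-assoc (bit (f 0 ∧ not p)) _ _)))

runs-zero : ∀ {f} N → runs false f N ≡ 0 → count f N ≡ 0
runs-zero zero eq = refl
runs-zero {f} (suc N) eq with f 0
... | false = runs-zero N eq

-- Killing a window creates at most one run, and only by cutting through a run of length ≥ 6.
split-or-full : ∀ p a b c d e →
  bit e ≤ starts p a b c d e ⊎ bit a + bit b + bit c + bit d ≡ 4
split-or-full p a b c d false = inj₁ z≤n
split-or-full p a b c false true = inj₁ (m≤n+m 1 _)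
split-or-full p a b false true true = inj₁ (≤-trans (m≤n+m 1 (bit (a ∧ not p) + bit (b ∧ not a) + bit (false ∧ not b))) (m≤m+n _ 0))
split-or-full p a false true true true = inj₁ (≤-trans (m≤n+m 1 (bit (a ∧ not p) + bit (false ∧ not a))) (≤-trans (m≤m+n _ 0) (m≤m+n _ 0)))
split-or-full p false true true true true =
  inj₁ (≤-trans (m≤n+m 1 (bit (false ∧ not p))) (≤-trans (m≤m+n _ 0) (≤-trans (m≤m+n _ 0) (m≤m+n _ 0))))
split-or-full p true true true true true = inj₂ refl

-- An isolated live cell adds one to both counts, so the search can skip it and keep the strict
-- inequality until a run of length two appears.
find-long-run : ∀ f N → runs false f N < count f N →
  ∃[ y ] prev false f y ≡ false × f y ≡ true × f (1 + y) ≡ true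
find-long-run f (suc N) lt with f 0 in eq₀
... | false = let (y , p , a , b) = find-long-run (f ∘ suc) N lt
              in suc y , trans (cong (λ q → prev q (f ∘ suc) y) eq₀) p , a , b
find-long-run f (suc zero) (s≤s ()) | true
find-long-run f (suc (suc N)) (s≤s lt) | true with f 1 in eq₁
... | true  = 0 , refl , eq₀ , eq₁
... | false = let (y , p , a , b) = find-long-run (λ i → f (2 + i)) N lt
              in 2 + y , trans (cong (λ q → prev q (λ i → f (2 + i)) y) eq₁) p , a , b

-- Walking away from three dead cells, the first window to meet a live cell contains exactly one.
after-gap : ∀ f g k → f g ≡ false → f (1 + g) ≡ false → f (2 + g) ≡ false →
  f (k + (3 + g)) ≡ true → ∃[ y ] g ≤ y × y ≤ k + g × hit f y ≡ 1
after-gap f g k d₀ d₁ d₂ live with f (3 + g) in eq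
after-gap f g k d₀ d₁ d₂ live | true = g , ≤-refl , m≤n+m g k , hit≡1
  where
  hit≡1 : hit f g ≡ 1
  hit≡1 rewrite d₀ | d₁ | d₂ | eq = refl
after-gap f g zero d₀ d₁ d₂ live | false with () ← trans (sym live) eq
after-gap f g (suc k) d₀ d₁ d₂ live | false =
  let (y , g<y , y≤ , h) = after-gap f (suc g) k d₁ d₂ eq (trans (cong f (+-suc k (3 + g))) live)
  in y , <⇒≤ g<y , subst (y ≤_) (+-suc k g) y≤ , h

-- Mirror image of `after-gap`: the window moves to smaller indices until its first cell is live.
before-gap : ∀ f i k → f (1 + k + i) ≡ false → f (2 + k + i) ≡ false → f (3 + k + i) ≡ false →
  f i ≡ true → ∃[ y ] y ≤ k + i × hit f y ≡ 1
before-gap f i k d₁ d₂ d₃ live with f (k + i) in eq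
before-gap f i k d₁ d₂ d₃ live | true = k + i , ≤-refl , hit≡1
  where
  hit≡1 : hit f (k + i) ≡ 1
  hit≡1 rewrite d₁ | d₂ | d₃ | eq = refl
before-gap f i zero d₁ d₂ d₃ live | false with () ← trans (sym live) eq
before-gap f i (suc k) d₁ d₂ d₃ live | false =
  let (y , y≤ , h) = before-gap f i k eq d₁ d₂ live in y , m≤n⇒m≤1+n y≤ , h

count-pos : ∀ f N → 0 < count f N → ∃[ i ] f i ≡ true
count-pos f (suc N) pos with f 0 in eq
... | true  = 0 , eq
... | false = let (i , live) = count-pos (f ∘ suc) N pos in suc i , live

count-false : ∀ f N → (∀ i → f i ≡ false) → count f N ≡ 0
count-false f zero    dead = refl
count-false f (suc N) dead rewrite dead 0 = count-false (f ∘ suc) N (dead ∘ suc)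

runs-false : ∀ p f N → (∀ i → f i ≡ false) → runs p f N ≡ 0
runs-false p f zero    dead = refl
runs-false p f (suc N) dead rewrite dead 0 = runs-false false (f ∘ suc) N (dead ∘ suc)

count-prefix : ∀ k N → k ≤ N → count (_<ᵇ k) N ≡ k
count-prefix zero    N       z≤n       = count-false (_<ᵇ 0) N λ _ → refl
count-prefix (suc k) (suc N) (s≤s k≤N) = cong suc (count-prefix k N k≤N)

runs-prefix : ∀ k N → runs true (_<ᵇ k) N ≡ 0
runs-prefix zero    N       = runs-false true (_<ᵇ 0) N λ _ → refl
runs-prefix (suc k) zero    = refl
runs-prefix (suc k) (suc N) = runs-prefix k N

-- Positions of the game as rows

∨-true : ∀ {a b} → a ∨ b ≡ true → a ≡ true ⊎ b ≡ true
∨-true {true}  eq = inj₁ refl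
∨-true {false} eq = inj₂ eq

∨-trueˡ : ∀ {a} b → a ≡ true → a ∨ b ≡ true
∨-trueˡ b refl = refl

∨-trueʳ : ∀ a {b} → b ≡ true → a ∨ b ≡ true
∨-trueʳ a refl = ∨-zeroʳ a

∧-true : ∀ {a b} → a ≡ true → b ≡ true → a ∧ b ≡ true
∧-true refl refl = refl

any-intro : ∀ {n} (p : Fin n → Bool) i → p i ≡ true → any p (allFin n) ≡ true
any-intro p i eq = Equivalence.to T-≡ (any⁺ p (lose (∈-allFin i) (Equivalence.from T-≡ eq)))

any-elim : ∀ {n} (p : Fin n → Bool) → any p (allFin n) ≡ true → ∃[ i ] p i ≡ true
any-elim p eq = let (i , _ , t) = find (any⁻ p (allFin _) (Equivalence.from T-≡ eq)) in i , Equivalence.to T-≡ t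

≡ᵇ-sound : ∀ m n → (m ≡ᵇ n) ≡ true → m ≡ n
≡ᵇ-sound m n eq = ≡ᵇ⇒≡ m n (Equivalence.from T-≡ eq)

≡ᵇ-refl : ∀ m → (m ≡ᵇ m) ≡ true
≡ᵇ-refl m = Equivalence.to T-≡ (≡⇒≡ᵇ m m refl)

==-sound : ∀ {n} (i j : Fin n) → (i == j) ≡ true → i ≡ j
==-sound i j eq with i ≟ j
... | yes i≡j = i≡j

==-refl : ∀ {n} (i : Fin n) → (i == i) ≡ true
==-refl i with i ≟ i
... | yes _   = refl
... | no  i≢i = ⊥-elim (i≢i refl)

module _ {n} (G : Graph n) (X : VSet n) where

  -- Of a walk that leaves `v` only the first step is kept: a live neighbour of `v` is all that a
  -- component of order at least two has to provide.
  reach-alive : ∀ k v w → reachWithin G X k v w ≡ true →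
    alive G X v ≡ true × (v ≡ w ⊎ ∃[ u ] alive G X u ≡ true × adj G v u ≡ true)
  reach-alive zero v w r = ∧-conicalˡ _ _ r , inj₁ (==-sound v w (∧-conicalʳ _ _ r))
  reach-alive (suc k) v w r with ∨-true r
  ... | inj₁ r′ = reach-alive k v w r′
  ... | inj₂ r′ with any-elim _ r′
  ...   | u , s with reach-alive k v u (∧-conicalˡ _ _ s)
  ...     | a , inj₁ refl = a , inj₂ (w , ∧-conicalˡ (alive G X w) (adj G v w) s′ , ∧-conicalʳ (alive G X w) (adj G v w) s′)
    where
    s′ : alive G X w ∧ adj G v w ≡ true
    s′ = ∧-conicalʳ (reachWithin G X k v v) _ s
  ...     | a , inj₂ t    = a , inj₂ t

  reach-refl : ∀ k v → alive G X v ≡ true → reachWithin G X k v v ≡ true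
  reach-refl zero    v a = ∧-true a (==-refl v)
  reach-refl (suc k) v a = ∨-trueˡ _ (reach-refl k v a)

  big⇒edge : ∀ v → inBigComponent G X v ≡ true →
    alive G X v ≡ true × ∃[ u ] alive G X u ≡ true × adj G v u ≡ true
  big⇒edge v b with any-elim _ b
  ... | w , s with reach-alive n v w (∧-conicalʳ _ _ s)
  ...   | a , inj₂ t = a , t
  ...   | a , inj₁ refl with () ← trans (sym (∧-conicalˡ _ _ s)) (cong not (==-refl v))

adj⇒== : ∀ {n} (G : Graph n) v w → adj G v w ≡ true → not (v == w) ≡ true
adj⇒== G v w e with v ≟ w
... | no  _    = refl
... | yes refl with () ← trans (sym e) (adj-irrefl G v)

-- With `big⇒edge` this replaces components by live edges. The walk stays at `v` and uses only its
-- last permitted step, which exists because the order is a successor.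
edge⇒big : ∀ {n} (G : Graph n) X v w → alive G X v ≡ true → alive G X w ≡ true →
  adj G v w ≡ true → inBigComponent G X v ≡ true
edge⇒big {suc n} G X v w a b e = any-intro (λ u → not (v == u) ∧ sameComponent G X v u) w (∧-true (adj⇒== G v w e)
  (∨-trueʳ (reachWithin G X n v w) (any-intro (λ u → reachWithin G X n v u ∧ (alive G X w ∧ adj G u w)) v (∧-true (reach-refl G X n v a) (∧-true b e)))))

alive-insert : ∀ {n} (G : Graph n) X y v →
  alive G (insert y X) v ≡ alive G X v ∧ not (dominates G y v)
alive-insert {n} G X y v = trans (cong not nbhd) (not-∨ (inClosedNbhd G X v) (dominates G y v))
  where
  not-∨ : ∀ a b → not (a ∨ b) ≡ not a ∧ not b
  not-∨ false b = refl
  not-∨ true  b = refl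
  covers : VSet n → Fin n → Bool
  covers Y x = Y x ∧ dominates G x v
  to : inClosedNbhd G (insert y X) v ≡ true → inClosedNbhd G X v ∨ dominates G y v ≡ true
  to t with any-elim (covers (insert y X)) t
  ... | x , s with ∨-true {X x} (∧-conicalˡ (insert y X x) (dominates G x v) s)
                 | ∧-conicalʳ (insert y X x) (dominates G x v) s
  ...   | inj₁ x∈X | d = ∨-trueˡ _ (any-intro (covers X) x (∧-true x∈X d))
  ...   | inj₂ y=x | d rewrite ==-sound y x y=x = ∨-trueʳ (inClosedNbhd G X v) d
  from : inClosedNbhd G X v ∨ dominates G y v ≡ true → inClosedNbhd G (insert y X) v ≡ true
  from t with ∨-true {inClosedNbhd G X v} t
  ... | inj₂ d = any-intro (covers (insert y X)) y (∧-true (∨-trueʳ (X y) (==-refl y)) d)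
  ... | inj₁ c with any-elim (covers X) c
  ...   | x , s = any-intro (covers (insert y X)) x
    (∧-true (∨-trueˡ (y == x) (∧-conicalˡ (X x) _ s)) (∧-conicalʳ (X x) (dominates G x v) s))
  nbhd : inClosedNbhd G (insert y X) v ≡ inClosedNbhd G X v ∨ dominates G y v
  nbhd = ⇔→≡ (mk⇔ to from)

near : ℕ → Row
near y i = (y ≡ᵇ i) ∨ ((suc y ≡ᵇ i) ∨ (suc i ≡ᵇ y))

dominates-path : ∀ {n} (x v : Fin n) → dominates (P n) x v ≡ near (toℕ x) (toℕ v)
dominates-path x v = cong (_∨ pathAdj x v) (⇔→≡ (mk⇔ to from))
  where
  to : (x == v) ≡ true → (toℕ x ≡ᵇ toℕ v) ≡ true
  to t rewrite ==-sound x v t = ≡ᵇ-refl (toℕ v)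
  from : (toℕ x ≡ᵇ toℕ v) ≡ true → (x == v) ≡ true
  from t rewrite toℕ-injective (≡ᵇ-sound (toℕ x) (toℕ v) t) = ==-refl v

-- An edge dies when either end is dominated. The move `y` thus kills the edges whose smaller end is
-- between `y - 2` and `y + 1`; the shift by two keeps these indices natural.
window-near : ∀ y i → window y (2 + i) ≡ near y i ∨ near y (suc i)
window-near zero zero = refl
window-near zero (suc zero) = refl
window-near zero (suc (suc i)) = refl
window-near (suc zero) zero = refl
window-near (suc (suc zero)) zero = refl
window-near (suc (suc (suc y))) zero = refl
window-near (suc y) (suc i) = window-near y i

-- Positions past the last vertex count as dead, so the right end of the path needs no separate
-- treatment.
extend : ∀ {n} → VSet n → Row
extend {zero}  g m       = false
extend {suc n} g zero    = g zero
extend {suc n} g (suc m) = extend (g ∘ suc) m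

extend-toℕ : ∀ {n} (g : VSet n) i → extend g (toℕ i) ≡ g i
extend-toℕ g zero    = refl
extend-toℕ g (suc i) = extend-toℕ (g ∘ suc) i

extend-true : ∀ {n} (g : VSet n) m → extend g m ≡ true → ∃[ i ] toℕ i ≡ m × g i ≡ true
extend-true {suc n} g zero    t = zero , refl , t
extend-true {suc n} g (suc m) t = let (i , eq , a) = extend-true (g ∘ suc) m t in suc i , cong suc eq , a

extend-∧ : ∀ {n} (g g′ : VSet n) (h : Row) → (∀ v → g′ v ≡ g v ∧ h (toℕ v)) →
  ∀ m → extend g′ m ≡ extend g m ∧ h m
extend-∧ {zero}  g g′ h eq m       = refl
extend-∧ {suc n} g g′ h eq zero    = eq zero
extend-∧ {suc n} g g′ h eq (suc m) = extend-∧ (g ∘ suc) (g′ ∘ suc) (h ∘ suc) (eq ∘ suc) m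

-- Cell 2 + i is the edge between vertices i and i + 1; with this shift the move y is window y.
cells : Row → Row
cells u zero          = false
cells u (suc zero)    = false
cells u (suc (suc i)) = u i ∧ u (suc i)

opaque
  row : ∀ {n} → VSet n → Row
  row {n} X = cells (extend (alive (P n) X))

  row-insert : ∀ {n} (X : VSet n) y → Kill (toℕ y) (row X) (row (insert y X))
  row-insert X y zero          = refl
  row-insert X y (suc zero)    = refl
  row-insert {n} X y (suc (suc i)) rewrite window-near (toℕ y) i =
    trans (cong₂ _∧_ (ext i) (ext (suc i))) (regroup (extend (alive (P n) X) i) (extend (alive (P n) X) (suc i)) (near (toℕ y) i) (near (toℕ y) (suc i)))
    where
    ext : ∀ m → extend (alive (P n) (insert y X)) m ≡ extend (alive (P n) X) m ∧ not (near (toℕ y) m)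
    ext = extend-∧ (alive (P n) X) (alive (P n) (insert y X)) (λ m → not (near (toℕ y) m))
      λ v → trans (alive-insert (P n) X y v) (cong (λ b → alive (P n) X v ∧ not b) (dominates-path y v))
    regroup : ∀ a b c d → (a ∧ not c) ∧ (b ∧ not d) ≡ (a ∧ b) ∧ not (c ∨ d)
    regroup false b c d = refl
    regroup true false c d = ∧-zeroʳ (not c)
    regroup true true false d = refl
    regroup true true true d = refl

window-hit : ∀ f y i → window y i ≡ true → f i ≡ true → 0 < hit f y
window-hit f zero zero w t rewrite t = s≤s z≤n
window-hit f zero (suc zero) w t rewrite t = ≤-trans (m≤n+m 1 (bit (f 0))) (≤-trans (m≤m+n _ _) (m≤m+n _ _))
window-hit f zero (suc (suc zero)) w t rewrite t = ≤-trans (m≤n+m 1 (bit (f 0) + bit (f 1))) (m≤m+n _ _)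
window-hit f zero (suc (suc (suc zero))) w t rewrite t = m≤n+m 1 _
window-hit f zero (suc (suc (suc (suc i)))) () t
window-hit f (suc y) (suc i) w t = window-hit (f ∘ suc) y i w t

hit-window : ∀ f y → 0 < hit f y → ∃[ i ] window y i ≡ true × f i ≡ true
hit-window f (suc y) h = let (i , w , t) = hit-window (f ∘ suc) y h in suc i , w , t
hit-window f zero h with f 0 in e₀ | f 1 in e₁ | f 2 in e₂ | f 3 in e₃
... | true  | _ | _ | _ = 0 , refl , e₀
... | false | true | _ | _ = 1 , refl , e₁
... | false | false | true | _ = 2 , refl , e₂
... | false | false | false | true = 3 , refl , e₃

adj-path : ∀ {n} (v w : Fin n) → toℕ w ≡ suc (toℕ v) → adj (P n) v w ≡ true
adj-path v w eq rewrite eq = ∨-trueˡ _ (≡ᵇ-refl (toℕ v))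

module _ {n} (X : VSet n) where

  opaque
    unfolding row

    extend-alive : ∀ v → alive (P n) X v ≡ true → extend (alive (P n) X) (toℕ v) ≡ true
    extend-alive v a = trans (extend-toℕ _ v) a

    -- A playable vertex dominates some `v` with a live neighbour `w`; the cell of the edge `vw`,
    -- indexed by the smaller end, lies in the window.
    playable⇒hit : ∀ y → playable (P n) X y ≡ true → 0 < hit (row X) (toℕ y)
    playable⇒hit y p with any-elim _ p
    ... | v , s with big⇒edge (P n) X v (∧-conicalʳ _ _ s) | trans (sym (dominates-path y v)) (∧-conicalˡ _ _ s)
    ...   | a , w , b , e | d with ∨-true e
    ...     | inj₁ v+1 = window-hit (row X) (toℕ y) (2 + toℕ v)
        (trans (window-near (toℕ y) (toℕ v)) (∨-trueˡ _ d))
        (∧-true (extend-alive v a) (trans (cong (extend (alive (P n) X)) (≡ᵇ-sound (suc (toℕ v)) (toℕ w) v+1)) (extend-alive w b)))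
    ...     | inj₂ w+1 = window-hit (row X) (toℕ y) (2 + toℕ w)
        (trans (window-near (toℕ y) (toℕ w)) (∨-trueʳ (near (toℕ y) (toℕ w)) (trans (cong (near (toℕ y)) (≡ᵇ-sound (suc (toℕ w)) (toℕ v) w+1)) d)))
        (∧-true (extend-alive w b) (trans (cong (extend (alive (P n) X)) (≡ᵇ-sound (suc (toℕ w)) (toℕ v) w+1)) (extend-alive v a)))

    -- Both ends of a live edge in the window are alive, and `y` dominates one of them; that end is
    -- the witness.
    hit⇒playable : ∀ y → 0 < hit (row X) (toℕ y) → playable (P n) X y ≡ true
    hit⇒playable y h with hit-window (row X) (toℕ y) h
    ... | suc (suc i) , wd , t with extend-true (alive (P n) X) i (∧-conicalˡ _ _ t)
                                  | extend-true (alive (P n) X) (suc i) (∧-conicalʳ _ _ t)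
    ...   | v , v≡i , a | w , w≡1+i , b with ∨-true {near (toℕ y) i} (trans (sym (window-near (toℕ y) i)) wd)
    ...     | inj₁ d = any-intro _ v (∧-true (trans (dominates-path y v) (trans (cong (near (toℕ y)) v≡i) d))
                         (edge⇒big (P n) X v w a b v~w))
      where
      v~w : adj (P n) v w ≡ true
      v~w = adj-path v w (trans w≡1+i (cong suc (sym v≡i)))
    ...     | inj₂ d = any-intro _ w (∧-true (trans (dominates-path y w) (trans (cong (near (toℕ y)) w≡1+i) d))
                         (edge⇒big (P n) X w v b a (trans (adj-sym (P n) w v) v~w)))
      where
      v~w : adj (P n) v w ≡ true
      v~w = adj-path v w (trans w≡1+i (cong suc (sym v≡i)))

    -- Guarantees that positions found by searching a row are vertices of the path.
    row-bounds : ∀ i → row X i ≡ true → ∃[ j ] i ≡ 2 + j × 2 + j ≤ n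
    row-bounds (suc (suc j)) t with extend-true (alive (P n) X) (suc j) (∧-conicalʳ (extend (alive (P n) X) j) _ t)
    ... | v , eq , _ = j , refl , subst (_< n) eq (toℕ<n v)

opaque
  unfolding row

  row-∅ : ∀ {m} i → row {suc m} ∅ (2 + i) ≡ (i <ᵇ m)
  row-∅ {m} i = trans (cong₂ _∧_ (all-true _ all-alive i) (all-true _ all-alive (suc i))) (lemma i m)
    where
    all-true : ∀ {n} (g : VSet n) → (∀ v → g v ≡ true) → ∀ i → extend g i ≡ (i <ᵇ n)
    all-true {zero}  g t i       = refl
    all-true {suc n} g t zero    = t zero
    all-true {suc n} g t (suc i) = all-true (g ∘ suc) (t ∘ suc) i
    all-alive : ∀ v → alive (P (suc m)) ∅ v ≡ true
    all-alive v with inClosedNbhd (P (suc m)) ∅ v in eq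
    ... | false = refl
    ... | true with () ← proj₂ (any-elim (λ x → ∅ x ∧ dominates (P (suc m)) x v) eq)
    lemma : ∀ i m → (i <ᵇ suc m) ∧ (i <ᵇ m) ≡ (i <ᵇ m)
    lemma zero    m       = refl
    lemma (suc i) zero    = ∧-zeroʳ (i <ᵇ 0)
    lemma (suc i) (suc m) = lemma i m

  row-0 : ∀ {n} (X : VSet n) → row X 0 ≡ false
  row-0 X = refl

  row-1 : ∀ {n} (X : VSet n) → row X 1 ≡ false
  row-1 X = refl

-- Optimal moves

foldr-⊓-≤ : ∀ {a x} as → x ∈ a ∷ as → foldr _⊓_ a as ≤ x
foldr-⊓-≤ []       (here refl)         = ≤-refl
foldr-⊓-≤ (b ∷ as) (here refl)         = ≤-trans (m⊓n≤n b _) (foldr-⊓-≤ as (here refl))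
foldr-⊓-≤ (b ∷ as) (there (here refl)) = m⊓n≤m b _
foldr-⊓-≤ (b ∷ as) (there (there x∈))  = ≤-trans (m⊓n≤n b _) (foldr-⊓-≤ as (there x∈))

≤-foldr-⊔ : ∀ {a x} as → x ∈ a ∷ as → x ≤ foldr _⊔_ a as
≤-foldr-⊔ []       (here refl)         = ≤-refl
≤-foldr-⊔ (b ∷ as) (here refl)         = ≤-trans (≤-foldr-⊔ as (here refl)) (m≤n⊔m b _)
≤-foldr-⊔ (b ∷ as) (there (here refl)) = m≤m⊔n b _
≤-foldr-⊔ (b ∷ as) (there (there x∈))  = ≤-trans (≤-foldr-⊔ as (there x∈)) (m≤n⊔m b _)

module _ {n} (G : Graph n) where

  optimum-∈ : ∀ p a as → optimum G p a as ∈ a ∷ as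
  optimum-∈ dominator a as = [ here , there ]′ (foldr-selective ⊓-sel a as)
  optimum-∈ staller   a as = [ here , there ]′ (foldr-selective ⊔-sel a as)

  playable-∈ : ∀ X y → playable G X y ≡ true → y ∈ filterᵇ (playable G X) (verts G)
  playable-∈ X y p = ∈-filter⁺ (T? ∘ playable G X) (∈-allFin y) (Equivalence.from T-≡ p)

  -- Serves the player whose strategy is not prescribed: the optimum is attained, so a bound valid
  -- after every playable move bounds the value.
  best-move : ∀ f p X → value G (suc f) p X ≡ 0 × (∀ y → playable G X y ≢ true) ⊎
    ∃[ y ] playable G X y ≡ true × value G (suc f) p X ≡ suc (value G f (other G p) (insert y X))
  best-move f p X with filterᵇ (playable G X) (verts G) in eq
  ... | []     = inj₁ (refl , λ y pl → ∉[] (subst (y ∈_) eq (playable-∈ X y pl)))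
    where
    ∉[] : ∀ {y} → y ∈ [] → _
    ∉[] ()
  ... | x ∷ xs with ∈-map⁻ (λ y → value G f (other G p) (insert y X)) {xs = x ∷ xs} (optimum-∈ p _ (map _ xs))
  ...   | y , y∈ , v = inj₂ (y , playable-y , cong suc v)
    where
    playable-y : playable G X y ≡ true
    playable-y = Equivalence.to T-≡ (proj₂ (∈-filter⁻ (T? ∘ playable G X) {xs = verts G} (subst (y ∈_) (sym eq) y∈)))

  dominator-≤ : ∀ f X y → playable G X y ≡ true →
    value G (suc f) dominator X ≤ suc (value G f staller (insert y X))
  dominator-≤ f X y pl with filterᵇ (playable G X) (verts G) | playable-∈ X y pl
  ... | x ∷ xs | y∈ = s≤s (foldr-⊓-≤ (map _ xs) (∈-map⁺ (λ z → value G f staller (insert z X)) y∈))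

  staller-≥ : ∀ f X y → playable G X y ≡ true →
    suc (value G f dominator (insert y X)) ≤ value G (suc f) staller X
  staller-≥ f X y pl with filterᵇ (playable G X) (verts G) | playable-∈ X y pl
  ... | x ∷ xs | y∈ = s≤s (≤-foldr-⊔ (map _ xs) (∈-map⁺ (λ z → value G f dominator (insert z X)) y∈))

-- Effect of a move on edges, components and weight

pos⇒run-pos : ∀ {f} N → 0 < count f N → 0 < runs false f N
pos⇒run-pos {f} N pos with runs false f N in eq
... | suc _ = s≤s z≤n
... | zero  = subst (0 <_) (runs-zero {f} N eq) pos

bit-≤1 : ∀ b → bit b ≤ 1
bit-≤1 false = z≤n
bit-≤1 true  = ≤-refl

hit-≤4 : ∀ f y → hit f y ≤ 4
hit-≤4 f y = +-mono-≤ (+-mono-≤ (+-mono-≤ (bit-≤1 (f y)) (bit-≤1 (f (1 + y)))) (bit-≤1 (f (2 + y)))) (bit-≤1 (f (3 + y)))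

-- For a window placed at the start of a run of length at least two. If the run ends inside, at
-- least two edges and one component vanish, weight 2 * 2 + 4; otherwise four edges vanish and no
-- component is added, weight 2 * 4. Either way the drop is at least 8.
run-end-or-full : ∀ c d e → 1 + bit e ≤ starts false true true c d e ⊎
  bit c + bit d ≡ 2 × starts false true true c d e ≡ 1
run-end-or-full true  true  false = inj₂ (refl , refl)
run-end-or-full true  true  true  = inj₂ (refl , refl)
run-end-or-full true  false false = inj₁ ≤-refl
run-end-or-full true  false true  = inj₁ ≤-refl
run-end-or-full false true  false = inj₁ (m≤n+m 1 1)
run-end-or-full false true  true  = inj₁ ≤-refl
run-end-or-full false false false = inj₁ ≤-refl
run-end-or-full false false true  = inj₁ ≤-refl

module _ {n : ℕ} where

  hits : VSet n → Fin n → ℕ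
  hits X y = hit (row X) (toℕ y)

  opaque
    -- Length `4 + n` leaves room for the window of the last vertex `n - 1` and for the cell after
    -- it.
    edges comps : VSet n → ℕ
    edges X = count (row X) (4 + n)
    comps X = runs false (row X) (4 + n)

    edges-insert : ∀ X y → edges X ≡ edges (insert y X) + hits X y
    edges-insert X y = count-kill (toℕ y) (4 + n) (row-insert X y) (+-monoʳ-≤ 4 (<⇒≤ (toℕ<n y)))

    comps-insert : ∀ X y → comps X + bit (row X (4 + toℕ y)) ≡ comps (insert y X) + startsAt false (row X) (toℕ y)
    comps-insert X y = runs-kill false (toℕ y) (4 + n) (row-insert X y) (+-monoʳ-≤ 4 (toℕ<n y))

    edges-pos⇒comps-pos : ∀ X → 0 < edges X → 0 < comps X
    edges-pos⇒comps-pos X = pos⇒run-pos {row X} (4 + n)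

    comps-zero⇒edges-zero : ∀ X → comps X ≡ 0 → edges X ≡ 0
    comps-zero⇒edges-zero X = runs-zero {row X} (4 + n)

    live-edge : ∀ X → 0 < edges X → ∃[ i ] row X i ≡ true
    live-edge X = count-pos (row X) (4 + n)

    long-run : ∀ X → comps X < edges X →
      ∃[ y ] prev false (row X) y ≡ false × row X y ≡ true × row X (1 + y) ≡ true
    long-run X = find-long-run (row X) (4 + n)

  weight : VSet n → ℕ
  weight X = 2 * edges X + 4 * comps X

  playable⇒smaller : ∀ X y → playable (P n) X y ≡ true → edges (insert y X) < edges X
  playable⇒smaller X y pl =
    subst (edges (insert y X) <_) (sym (edges-insert X y)) (m<m+n _ (playable⇒hit X y pl))

  playable⇒edges-pos : ∀ X y → playable (P n) X y ≡ true → 0 < edges X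
  playable⇒edges-pos X y pl = ≤-trans (s≤s z≤n) (playable⇒smaller X y pl)

  -- A move that adds a component kills four edges and so drops 8 - 4 = 4; any other move drops at
  -- least 2 per killed edge. This is why `h` is capped at 2.
  weight-drop : ∀ X y h → h ≤ 2 → h ≤ hits X y → weight (insert y X) + 2 * h ≤ weight X
  weight-drop X y h h≤2 h≤hits
    with split-or-full (prev false (row X) (toℕ y)) (row X (toℕ y)) (row X (1 + toℕ y)) (row X (2 + toℕ y))
           (row X (3 + toℕ y)) (row X (4 + toℕ y))
  ... | inj₁ r≤s = arith {E′ = edges (insert y X)} {C′ = comps (insert y X)} h≤hits r≤s (edges-insert X y) (comps-insert X y)
    where
    arith : ∀ {h t r s E E′ C C′} → h ≤ t → r ≤ s → E ≡ E′ + t → C + r ≡ C′ + s →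
            2 * E′ + 4 * C′ + 2 * h ≤ 2 * E + 4 * C
    arith {h} {t} {r} {s} {_} {E′} {C} {C′} h≤t r≤s refl eq =
      linear 0 (2 ⊙ h≤t ⊹ 4 ⊙ r≤s ⊹ 4 ⊙ ≤-reflexive (sym eq))
        (solve (h ∷ t ∷ r ∷ s ∷ E′ ∷ C ∷ C′ ∷ []))
  ... | inj₂ full = arith {E′ = edges (insert y X)} {C′ = comps (insert y X)} h≤2 (bit-≤1 (row X (4 + toℕ y))) full (edges-insert X y) (comps-insert X y)
    where
    arith : ∀ {h t r s E E′ C C′} → h ≤ 2 → r ≤ 1 → t ≡ 4 → E ≡ E′ + t → C + r ≡ C′ + s →
            2 * E′ + 4 * C′ + 2 * h ≤ 2 * E + 4 * C
    arith {h} {_} {r} {s} {_} {E′} {C} {C′} h≤2 r≤1 refl refl eq =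
      linear (4 * s) (2 ⊙ h≤2 ⊹ 4 ⊙ r≤1 ⊹ 4 ⊙ ≤-reflexive (sym eq))
        (solve (h ∷ r ∷ s ∷ E′ ∷ C ∷ C′ ∷ []))

  single-hit⇒comps-≤ : ∀ X y → hits X y ≡ 1 → comps (insert y X) ≤ comps X
  single-hit⇒comps-≤ X y one
    with split-or-full (prev false (row X) (toℕ y)) (row X (toℕ y)) (row X (1 + toℕ y)) (row X (2 + toℕ y))
           (row X (3 + toℕ y)) (row X (4 + toℕ y))
  ... | inj₂ full with () ← trans (sym one) full
  ... | inj₁ r≤s = arith {C′ = comps (insert y X)} r≤s (comps-insert X y)
    where
    arith : ∀ {r s C C′} → r ≤ s → C + r ≡ C′ + s → C′ ≤ C
    arith {r} {s} {C} {C′} r≤s eq = linear 0 (r≤s ⊹ ≤-reflexive (sym eq)) (solve (r ∷ s ∷ C ∷ C′ ∷ []))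

  vertex : ∀ y → y < n → (Q : ℕ → Set) → Q y → ∃[ v ] Q (toℕ {n} v)
  vertex y y<n Q q = fromℕ< y<n , subst Q (sym (toℕ-fromℕ< y<n)) q

  -- Dominator plays the third vertex of a component of order at least 3, wasting the first one.
  long-run-move : ∀ X → comps X < edges X → ∃[ y ] playable (P n) X y ≡ true ×
    weight (insert y X) + 8 ≤ weight X ×
    (comps X ≤ 1 → edges (insert y X) ≡ 0 ⊎ edges X ≡ edges (insert y X) + 4 × comps (insert y X) ≤ 1)
  long-run-move X lt with long-run X lt
  -- The second live cell, `1 + y₀`, is the one that forces `y₀ < n`.
  ... | y₀ , pr₀ , a₀ , b₀ with row-bounds X (1 + y₀) b₀
  ...   | j , eq , le with vertex y₀ (subst (_≤ n) (sym eq) le)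
                         (λ y → prev false (row X) y ≡ false × row X y ≡ true × row X (1 + y) ≡ true) (pr₀ , a₀ , b₀)
  ...   | y , pr , a , b = y , hit⇒playable X y (≤-trans (s≤s z≤n) two) , drop , single
    where
    c = row X (2 + toℕ y)
    d = row X (3 + toℕ y)
    e = row X (4 + toℕ y)
    E′ = edges (insert y X)
    C′ = comps (insert y X)
    hits-eq : hits X y ≡ 2 + (bit c + bit d)
    hits-eq rewrite a | b = refl
    two : 2 ≤ hits X y
    two = subst (2 ≤_) (sym hits-eq) (m≤m+n 2 _)
    s : ℕ
    s = starts false true true c d e
    edges-eq : edges X ≡ E′ + (2 + (bit c + bit d))
    edges-eq = trans (edges-insert X y) (cong (E′ +_) hits-eq)
    comps-eq : comps X + bit e ≡ C′ + s
    comps-eq = trans (comps-insert X y) (cong (C′ +_) starts-eq)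
      where
      starts-eq : startsAt false (row X) (toℕ y) ≡ s
      starts-eq rewrite pr | a | b = refl
    drop : weight (insert y X) + 8 ≤ weight X
    drop with run-end-or-full c d e
    ... | inj₁ end = arith {E′ = E′} {C′ = C′} end edges-eq comps-eq
      where
      arith : ∀ {t r s E E′ C C′} → 1 + r ≤ s → E ≡ E′ + (2 + t) → C + r ≡ C′ + s → 2 * E′ + 4 * C′ + 8 ≤ 2 * E + 4 * C
      arith {t} {r} {s} {_} {E′} {C} {C′} end refl eq =
        linear (2 * t) (4 ⊙ end ⊹ 4 ⊙ ≤-reflexive (sym eq))
          (solve (t ∷ r ∷ s ∷ E′ ∷ C ∷ C′ ∷ []))
    ... | inj₂ (full , s≡1) = arith {E′ = E′} {C′ = C′} full s≡1 (bit-≤1 e) edges-eq comps-eq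
      where
      arith : ∀ {t r s E E′ C C′} → t ≡ 2 → s ≡ 1 → r ≤ 1 → E ≡ E′ + (2 + t) → C + r ≡ C′ + s → 2 * E′ + 4 * C′ + 8 ≤ 2 * E + 4 * C
      arith {_} {r} {_} {_} {E′} {C} {C′} refl refl r≤1 refl eq =
        linear 0 (4 ⊙ r≤1 ⊹ 4 ⊙ ≤-reflexive (sym eq))
          (solve (r ∷ E′ ∷ C ∷ C′ ∷ []))
    single : comps X ≤ 1 → E′ ≡ 0 ⊎ edges X ≡ E′ + 4 × C′ ≤ 1
    single C≤1 with run-end-or-full c d e
    -- When the only run ends inside the window, no component is left.
    ... | inj₁ end = inj₁ (comps-zero⇒edges-zero (insert y X) (n≤0⇒n≡0 (arith {C′ = C′} end C≤1 comps-eq)))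
      where
      arith : ∀ {r s C C′} → 1 + r ≤ s → C ≤ 1 → C + r ≡ C′ + s → C′ ≤ 0
      arith {r} {s} {C} {C′} end C≤1 eq =
        linear 0 (end ⊹ C≤1 ⊹ ≤-reflexive (sym eq)) (solve (r ∷ s ∷ C ∷ C′ ∷ []))
    ... | inj₂ (full , s≡1) = inj₂ (trans edges-eq (cong (λ t → E′ + (2 + t)) full) , arith {C′ = C′} s≡1 (bit-≤1 e) C≤1 comps-eq)
      where
      arith : ∀ {r s C C′} → s ≡ 1 → r ≤ 1 → C ≤ 1 → C + r ≡ C′ + s → C′ ≤ 1
      arith {r} {_} {C} {C′} refl r≤1 C≤1 eq =
        linear 0 (r≤1 ⊹ C≤1 ⊹ ≤-reflexive (sym eq)) (solve (r ∷ C ∷ C′ ∷ []))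

-- Upper bounds

≤-∸1 : ∀ {v w} → v ≤ w ∸ 1 → v ≤ 0 ⊎ v < w
≤-∸1 {w = zero}  v≤ = inj₁ v≤
≤-∸1 {w = suc w} v≤ = inj₂ (s≤s v≤)

module _ {n : ℕ} where

  value-≤-edges : ∀ f p (X : VSet n) → value (P n) f p X ≤ edges X
  value-≤-edges zero    p X = z≤n
  value-≤-edges (suc f) p X with best-move (P n) f p X
  ... | inj₁ (eq , _)      = ≤-trans (≤-reflexive eq) z≤n
  ... | inj₂ (y , pl , eq) = ≤-trans (≤-reflexive eq)
    (≤-trans (s≤s (value-≤-edges f _ (insert y X))) (playable⇒smaller X y pl))

  3≤weight : ∀ (X : VSet n) → 0 < edges X → 3 ≤ weight X
  3≤weight X pos = arith pos (edges-pos⇒comps-pos X pos)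
    where
    arith : ∀ {e c} → 1 ≤ e → 1 ≤ c → 3 ≤ 2 * e + 4 * c
    arith {e} {c} e≥1 c≥1 = linear 3 (2 ⊙ e≥1 ⊹ 4 ⊙ c≥1) (solve (e ∷ c ∷ []))

  -- A pair of moves lowers the weight by 8 + 2, hence 5 per move. The offsets close the induction:
  -- 5 + (W - 8) + 2 = W - 1 and 5 + (W - 2) - 1 = W + 2.
  dominator-upper : ∀ f (X : VSet n) → 5 * value (P n) f dominator X ≤ weight X ∸ 1
  staller-upper : ∀ f (X : VSet n) → 5 * value (P n) f staller X ≤ weight X + 2

  dominator-upper zero X = z≤n
  dominator-upper (suc f) X with comps X <? edges X
  ... | yes lt = let (y , pl , drop , _) = long-run-move X lt in
    ∸-monoˡ-≤ 1 (arith (dominator-≤ (P n) f X y pl) (staller-upper f (insert y X)) drop)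
    where
    arith : ∀ {v v′ w w′} → v ≤ suc v′ → 5 * v′ ≤ w′ + 2 → w′ + 8 ≤ w → suc (5 * v) ≤ w
    arith {v} {v′} {w} {w′} h₁ h₂ h₃ = linear 0 (5 ⊙ h₁ ⊹ h₂ ⊹ h₃) (solve (v ∷ v′ ∷ w ∷ w′ ∷ []))
  -- Now E ≤ C, and at most E moves remain; 5E ≤ 2E + 4C - 1 holds as soon as E > 0.
  ... | no ≮ = arith (edges X) (value-≤-edges (suc f) dominator X) (≮⇒≥ ≮)
    where
    arith : ∀ {v c} e → v ≤ e → e ≤ c → 5 * v ≤ (2 * e + 4 * c) ∸ 1
    arith {v} {c} zero h₁ h₂ = ≤-trans (5 ⊙ h₁) z≤n
    arith {v} {c} (suc e) h₁ h₂ = ∸-monoˡ-≤ 1 bound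
      where
      bound : suc (5 * v) ≤ 2 * suc e + 4 * c
      bound = linear e (5 ⊙ h₁ ⊹ 4 ⊙ h₂) (solve (v ∷ e ∷ c ∷ []))

  staller-upper zero X = z≤n
  staller-upper (suc f) X with best-move (P n) f staller X
  ... | inj₁ (eq , _) = ≤-trans (5 ⊙ ≤-reflexive eq) z≤n
  ... | inj₂ (y , pl , eq) = ≤-trans (5 ⊙ ≤-reflexive eq)
    (arith (dominator-upper f (insert y X)) (weight-drop X y 1 (s≤s z≤n) (playable⇒hit X y pl))
      (3≤weight X (playable⇒edges-pos X y pl)))
    where
    arith : ∀ {v w w′} → 5 * v ≤ w′ ∸ 1 → w′ + 2 ≤ w → 3 ≤ w → 5 * suc v ≤ w + 2
    arith {v} {w} {w′} h₁ h₂ h₃ with ≤-∸1 {w = w′} h₁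
    -- Here `v = 0`, and the single move just made costs 5, which `3 ≤ w` covers.
    ... | inj₁ h = linear 0 (h ⊹ h₃) (solve (v ∷ w ∷ []))
    ... | inj₂ h = linear 0 (h ⊹ h₂) (solve (v ∷ w ∷ w′ ∷ []))

  -- A single component whose number of edges is 0 mod 5 with Staller to move, or 4 mod 5 with
  -- Dominator to move: Staller can only keep the residue by shortening the component by one vertex,
  -- and every other move of hers loses enough weight for staller-upper.
  dominator-single : ∀ f m (X : VSet n) → comps X ≤ 1 → edges X ≤ 5 * m + 4 →
    value (P n) f dominator X ≤ 2 * m + 1
  staller-single : ∀ f m (X : VSet n) → comps X ≤ 1 → edges X ≤ 5 * m →
    value (P n) f staller X ≤ 2 * m

  dominator-single zero m X C≤1 E≤ = z≤n
  dominator-single (suc f) m X C≤1 E≤ with m≤n⇒m<n∨m≡n E≤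
  -- With fewer than 5m + 4 edges the weight suffices: 5v ≤ 2(5m + 3) + 4 - 1 < 5(2m + 2).
  ... | inj₁ E< = ≤-pred (*-cancelˡ-< 5 (value (P n) (suc f) dominator X) (suc (2 * m + 1)) (arith {value (P n) (suc f) dominator X} C≤1 E< (dominator-upper (suc f) X)))
    where
    arith : ∀ {v e c} → c ≤ 1 → suc e ≤ 5 * m + 4 → 5 * v ≤ (2 * e + 4 * c) ∸ 1 → 5 * v < 5 * suc (2 * m + 1)
    arith {v} {e} {c} h₁ h₂ h₃ with ≤-∸1 {w = 2 * e + 4 * c} h₃
    ... | inj₁ h = linear (10 * m + 9) h (solve (v ∷ m ∷ []))
    ... | inj₂ h = linear 0 (h ⊹ 2 ⊙ h₂ ⊹ 4 ⊙ h₁) (solve (v ∷ m ∷ e ∷ c ∷ []))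
  -- With exactly 5m + 4 edges the long-run move ends the game or leaves at most one component, with
  -- 5m edges.
  ... | inj₂ E≡ with long-run-move X (≤-trans (s≤s C≤1) (≤-trans (m≤n+m 2 (5 * m + 2)) (≤-reflexive (trans (+-assoc (5 * m) 2 2) (sym E≡)))))
  ...   | y , pl , _ , single with single C≤1
  ...     | inj₁ E′≡0 = ≤-trans (dominator-≤ (P n) f X y pl)
      (≤-trans (s≤s (≤-trans (value-≤-edges f staller (insert y X)) (≤-reflexive E′≡0))) (m≤n+m 1 (2 * m)))
  ...     | inj₂ (E-eq , C′≤1) = ≤-trans (dominator-≤ (P n) f X y pl)
      (≤-trans (s≤s (staller-single f m (insert y X) C′≤1
        (≤-reflexive (+-cancelʳ-≡ 4 _ _ (trans (sym E-eq) E≡))))) (≤-reflexive (+-comm 1 (2 * m))))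

  staller-single f zero X C≤1 E≤ = ≤-trans (value-≤-edges f staller X) E≤
  staller-single zero (suc m) X C≤1 E≤ = z≤n
  staller-single (suc f) (suc m) X C≤1 E≤ with best-move (P n) f staller X
  ... | inj₁ (eq , _) = ≤-trans (≤-reflexive eq) z≤n
  ... | inj₂ (y , pl , eq) with m≤n⇒m<n∨m≡n (playable⇒hit X y pl)
  ...   | inj₂ one = ≤-trans (≤-reflexive eq)
      (arith₁ (dominator-single f m (insert y X) (≤-trans (single-hit⇒comps-≤ X y (sym one)) C≤1)
        (arith₂ (trans (edges-insert X y) (cong (edges (insert y X) +_) (sym one))) E≤)))
    where
    arith₁ : ∀ {v} → v ≤ 2 * m + 1 → suc v ≤ 2 * suc m
    arith₁ {v} h = linear 0 h (solve (v ∷ m ∷ []))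
    arith₂ : ∀ {e e′} → e ≡ e′ + 1 → e ≤ 5 * suc m → e′ ≤ 5 * m + 4
    arith₂ {_} {e′} refl h = linear 0 h (solve (e′ ∷ m ∷ []))
  -- Two killed edges cost weight 4, so 5v ≤ 10(m + 1) + 4 - 4 - 1 < 5(2m + 2).
  ...   | inj₁ two = ≤-trans (≤-reflexive eq)
      (arith {value (P n) f dominator (insert y X)} (dominator-upper f (insert y X)) (weight-drop X y 2 ≤-refl two) C≤1 E≤)
    where
    arith : ∀ {v w′ e c} → 5 * v ≤ w′ ∸ 1 → w′ + 4 ≤ 2 * e + 4 * c → c ≤ 1 → e ≤ 5 * suc m → suc v ≤ 2 * suc m
    arith {v} {w′} {e} {c} h₁ h₂ h₃ h₄ with ≤-∸1 {w = w′} h₁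
    ... | inj₁ h = *-cancelˡ-< 5 v (2 * suc m) (linear (10 * m + 9) h (solve (v ∷ m ∷ [])))
    ... | inj₂ h = *-cancelˡ-< 5 v (2 * suc m) (linear 0 (h ⊹ h₂ ⊹ 4 ⊙ h₃ ⊹ 2 ⊙ h₄) (solve (v ∷ w′ ∷ e ∷ c ∷ m ∷ [])))

-- Lower bounds

-- For e > 0 these solve d(e) = 1 + s(e ∸ 4) and s(e) = 1 + d(e ∸ 1): Dominator kills four edges,
-- Staller one.
dominatorBound : ℕ → ℕ
dominatorBound 0 = 0
dominatorBound 1 = 1
dominatorBound 2 = 1
dominatorBound 3 = 1
dominatorBound 4 = 1
dominatorBound (suc (suc (suc (suc (suc e))))) = 2 + dominatorBound e

stallerBound : ℕ → ℕ
stallerBound 0 = 0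
stallerBound 1 = 1
stallerBound 2 = 2
stallerBound 3 = 2
stallerBound 4 = 2
stallerBound (suc (suc (suc (suc (suc e))))) = 2 + stallerBound e

dominatorBound-step : ∀ e → dominatorBound e ≤ dominatorBound (suc e)
dominatorBound-step 0 = z≤n
dominatorBound-step 1 = ≤-refl
dominatorBound-step 2 = ≤-refl
dominatorBound-step 3 = ≤-refl
dominatorBound-step 4 = s≤s z≤n
dominatorBound-step (suc (suc (suc (suc (suc e))))) = s≤s (s≤s (dominatorBound-step e))

dominatorBound-4+ : ∀ e → dominatorBound (4 + e) ≡ suc (stallerBound e)
dominatorBound-4+ 0 = refl
dominatorBound-4+ 1 = refl
dominatorBound-4+ 2 = refl
dominatorBound-4+ 3 = refl
dominatorBound-4+ 4 = refl
dominatorBound-4+ (suc (suc (suc (suc (suc e))))) = cong (2 +_) (dominatorBound-4+ e)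

-- By monotonicity the case `h = 4` is decisive, and there the recursion is an equality.
dominatorBound-≤ : ∀ e h → h ≤ 4 → dominatorBound (e + h) ≤ suc (stallerBound e)
dominatorBound-≤ e h h≤4 = subst (dominatorBound (e + h) ≤_) (trans (cong dominatorBound shift) (dominatorBound-4+ e)) (mono (4 ∸ h) (e + h))
  where
  mono : ∀ k e → dominatorBound e ≤ dominatorBound (k + e)
  mono zero    e = ≤-refl
  mono (suc k) e = ≤-trans (mono k e) (dominatorBound-step (k + e))
  shift : (4 ∸ h) + (e + h) ≡ 4 + e
  shift = trans (cong ((4 ∸ h) +_) (+-comm e h)) (trans (sym (+-assoc (4 ∸ h) h e)) (cong (_+ e) (m∸n+n≡m h≤4)))

stallerBound-suc : ∀ e → stallerBound (suc e) ≤ suc (dominatorBound e)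
stallerBound-suc 0 = ≤-refl
stallerBound-suc 1 = ≤-refl
stallerBound-suc 2 = ≤-refl
stallerBound-suc 3 = ≤-refl
stallerBound-suc 4 = ≤-refl
stallerBound-suc (suc (suc (suc (suc (suc e))))) = s≤s (s≤s (stallerBound-suc e))

-- For the case where Dominator spends his move on the pendant edge alone: the turn passes and the
-- other edges stay.
dominatorBound≤stallerBound : ∀ e → dominatorBound e ≤ stallerBound e
dominatorBound≤stallerBound 0 = ≤-refl
dominatorBound≤stallerBound 1 = ≤-refl
dominatorBound≤stallerBound 2 = s≤s z≤n
dominatorBound≤stallerBound 3 = s≤s z≤n
dominatorBound≤stallerBound 4 = s≤s z≤n
dominatorBound≤stallerBound (suc (suc (suc (suc (suc e))))) = s≤s (s≤s (dominatorBound≤stallerBound e))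

window-offset : ∀ g k → window g (k + g) ≡ (k <ᵇ 4)
window-offset zero    k = cong (_<ᵇ 4) (+-identityʳ k)
window-offset (suc g) k = trans (cong (window (suc g)) (+-suc k g)) (window-offset g k)

window-below : ∀ y i → i < y → window y i ≡ false
window-below (suc y) zero    lt       = refl
window-below (suc y) (suc i) (s≤s lt) = window-below y i lt

window-zero : ∀ {i} → i < 3 → window 0 i ≡ true
window-zero {0} _ = refl
window-zero {1} _ = refl
window-zero {2} _ = refl
window-zero {suc (suc (suc _))} (s≤s (s≤s (s≤s ())))

window-cases : ∀ g i → i < g ⊎ window g i ≡ true ⊎ ∃[ k ] i ≡ k + (4 + g)
window-cases zero 0 = inj₂ (inj₁ refl)
window-cases zero 1 = inj₂ (inj₁ refl)
window-cases zero 2 = inj₂ (inj₁ refl)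
window-cases zero 3 = inj₂ (inj₁ refl)
window-cases zero (suc (suc (suc (suc k)))) = inj₂ (inj₂ (k , +-comm 4 k))
window-cases (suc g) zero = inj₁ (s≤s z≤n)
window-cases (suc g) (suc i) with window-cases g i
... | inj₁ lt              = inj₁ (s≤s lt)
... | inj₂ (inj₁ w)        = inj₂ (inj₁ w)
... | inj₂ (inj₂ (k , eq)) = inj₂ (inj₂ (k , trans (cong suc eq) (sym (+-suc k (4 + g)))))

module _ {n : ℕ} where

  -- What a selected vertex `g` leaves for the rest of the game: the dead cells from which Staller
  -- finds her single kills.
  Gap : ℕ → VSet n → Set
  Gap g X = ∀ i → window g i ≡ true → row X i ≡ false

  insert-gap : ∀ X y → Gap (toℕ y) (insert y X)
  insert-gap X y i w = Kill-inside {toℕ y} {row X} {row (insert y X)} (row-insert X y) w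

  gap-at : ∀ {X g} k → Gap g X → (k <ᵇ 4) ≡ true → row X (k + g) ≡ false
  gap-at {X} {g} k gap lt = gap (k + g) (trans (window-offset g k) lt)

  live⇒≤n : ∀ X i → row X i ≡ true → i ≤ n
  live⇒≤n X i t = let (j , eq , le) = row-bounds X i t in subst (_≤ n) (sym eq) le

  single-hit-after : ∀ X g k → Gap g X → row X (k + (4 + g)) ≡ true →
    ∃[ y ] g < toℕ y × hits X y ≡ 1
  single-hit-after X g k gap t =
    -- The search starts from the last three of the four dead cells, so the window found lies
    -- strictly past `g`.
    let (y , g<y , y≤ , h) = after-gap (row X) (1 + g) k (gap-at {X} 1 gap refl) (gap-at {X} 2 gap refl) (gap-at {X} 3 gap refl) t
        y<n = ≤-<-trans y≤ (<-≤-trans (+-monoʳ-< k (s≤s (s≤s (m≤n+m g 2)))) (live⇒≤n X _ t))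
    in vertex y y<n (λ y → g < y × hit (row X) y ≡ 1) (g<y , h)

  single-hit-move : ∀ X g → g < n → Gap g X → 0 < edges X → ∃[ y ] hits X y ≡ 1
  single-hit-move X g g<n gap pos with live-edge X pos
  ... | i , t with window-cases g i
  ...   | inj₂ (inj₁ w) with () ← trans (sym t) (gap i w)
  ...   | inj₂ (inj₂ (k , refl)) = let (y , _ , h) = single-hit-after X g k gap t in y , h
  ...   | inj₁ i<g with m≤n⇒∃[o]m+o≡n i<g
  ...     | k , refl rewrite +-comm i k =
    let (y , y≤ , h) = before-gap (row X) i k (gap-at {X} 0 gap refl) (gap-at {X} 1 gap refl) (gap-at {X} 2 gap refl) t
    in vertex y (≤-<-trans y≤ (<-trans (n<1+n (k + i)) g<n)) (λ y → hit (row X) y ≡ 1) h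

  -- The larger end of any live edge is playable.
  some-move : ∀ X → 0 < edges X → ∃[ y ] playable (P n) X y ≡ true
  some-move X pos with live-edge X pos
  ... | i , t with row-bounds X i t
  ...   | j , refl , le =
    let (y , h) = vertex (1 + j) le (λ y → 0 < hit (row X) y) (window-hit (row X) (1 + j) (2 + j) (window-offset j 1) t)
    in y , hit⇒playable X y h

  one⇒playable : ∀ X y → hits X y ≡ 1 → playable (P n) X y ≡ true
  one⇒playable X y one = hit⇒playable X y (≤-reflexive (sym one))

  one⇒edges : ∀ (X : VSet n) y → hits X y ≡ 1 → edges X ≡ suc (edges (insert y X))
  one⇒edges X y one = trans (edges-insert X y) (trans (cong (edges (insert y X) +_) one) (+-comm _ 1))

  -- Every move of Dominator kills at most four edges and leaves a gap, next to which Staller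
  -- replies by killing one. As each move kills an edge, fuel of at least `edges X` cannot cut the
  -- game short.
  dominator-lower : ∀ f X → edges X ≤ f → dominatorBound (edges X) ≤ value (P n) f dominator X
  staller-lower : ∀ f X g → g < n → Gap g X → edges X ≤ f → stallerBound (edges X) ≤ value (P n) f staller X

  dominator-lower zero X E≤ rewrite n≤0⇒n≡0 E≤ = z≤n
  dominator-lower (suc f) X E≤ with edges X in E≡
  ... | zero  = z≤n
  ... | suc e with best-move (P n) f dominator X
  ...   | inj₁ (_ , none) = let (y , pl) = some-move X (subst (0 <_) (sym E≡) (s≤s z≤n)) in ⊥-elim (none y pl)
  ...   | inj₂ (y , pl , eq) = ≤-trans (≤-trans (≤-reflexive (cong dominatorBound (trans (sym E≡) (edges-insert X y))))
      (dominatorBound-≤ (edges (insert y X)) (hits X y) (hit-≤4 (row X) (toℕ y))))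
      (≤-trans (s≤s (staller-lower f (insert y X) (toℕ y) (toℕ<n y) (insert-gap X y)
        (≤-pred (≤-trans (playable⇒smaller X y pl) (≤-trans (≤-reflexive E≡) E≤))))) (≤-reflexive (sym eq)))

  staller-lower zero X g g<n gap E≤ rewrite n≤0⇒n≡0 E≤ = z≤n
  staller-lower (suc f) X g g<n gap E≤ with edges X in E≡
  ... | zero = z≤n
  ... | suc e with single-hit-move X g g<n gap (subst (0 <_) (sym E≡) (s≤s z≤n))
  ...   | y , one = ≤-trans (stallerBound-suc e)
      (≤-trans (s≤s (subst (λ e → dominatorBound e ≤ value (P n) f dominator (insert y X)) E′≡
          (dominator-lower f (insert y X) (≤-trans (≤-reflexive E′≡) (≤-pred E≤)))))
        (staller-≥ (P n) f X y (one⇒playable X y one)))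
    where
    E′≡ : edges (insert y X) ≡ e
    E′≡ = suc-injective (trans (sym (one⇒edges X y one)) E≡)

  -- The first edge of the path is a component by itself.
  Pendant : VSet n → Set
  Pendant X = row X 2 ≡ true × Gap 3 X

  -- These windows stay within cells 0 to 5, where only cell 2 is live.
  pendant-hit : ∀ X → Pendant X → ∀ y → y ≤ 2 → hit (row X) y ≡ 1
  pendant-hit X (t , gap) 0 _ rewrite row-0 X | row-1 X | t | gap 3 refl = refl
  pendant-hit X (t , gap) 1 _ rewrite row-1 X | t | gap 3 refl | gap 4 refl = refl
  pendant-hit X (t , gap) 2 _ rewrite t | gap 3 refl | gap 4 refl | gap 5 refl = refl
  pendant-hit X _ (suc (suc (suc _))) (s≤s (s≤s ()))

  pendant-move : ∀ X → Pendant X → ∃[ y ] toℕ y ≡ 0 × hits X y ≡ 1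
  pendant-move X pend@(t , _) = vertex 0 (≤-trans (s≤s z≤n) (live⇒≤n X 2 t)) (λ y → y ≡ 0 × hit (row X) y ≡ 1)
    (refl , pendant-hit X pend 0 z≤n)

  pendant-insert : ∀ X y → Pendant X → 2 < toℕ y → Pendant (insert y X)
  pendant-insert X y (t , gap) 2<y =
    trans (Kill-outside {toℕ y} {row X} {row (insert y X)} (row-insert X y) (window-below (toℕ y) 2 2<y)) t ,
    λ i w → trans (row-insert X y i) (cong (_∧ _) (gap i w))

  -- After a hypothetical move at vertex 0 cells 0 to 6 are dead, yet an edge survives. It lies
  -- beyond the gap, so Staller can kill one edge there and spare the pendant one.
  pendant-single-hit : ∀ X e → Pendant X → edges X ≡ 2 + e → ∃[ y ] 2 < toℕ y × hits X y ≡ 1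
  pendant-single-hit X e pend@(t , gap) E≡ with pendant-move X pend
  ... | y , y≡0 , one with live-edge (insert y X)
          (subst (0 <_) (suc-injective (trans (sym E≡) (one⇒edges X y one))) (s≤s z≤n))
  ...   | i , t′ with trans (sym (row-insert X y i)) t′
  ...     | ti with window-cases 3 i
  ...       | inj₂ (inj₁ w) with () ← trans (sym ti) (cong (_∧ _) (gap i w))
  ...       | inj₂ (inj₂ (k , refl)) =
      let (z , 3<z , h) = single-hit-after X 3 k gap (∧-conicalˡ _ _ ti) in z , <⇒≤ 3<z , h
  ...       | inj₁ i<3 with () ← trans (sym t′) (insert-gap X y i (subst (λ y → window y i ≡ true) (sym y≡0) (window-zero i<3)))

  -- The pendant edge is worth a move of its own: no move kills it together with another edge, and
  -- Staller plays elsewhere while other edges remain.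
  pendant-dominator-lower : ∀ f X e → Pendant X → edges X ≡ suc e → edges X ≤ f →
    suc (dominatorBound e) ≤ value (P n) f dominator X
  pendant-staller-lower : ∀ f X e → Pendant X → edges X ≡ suc e → edges X ≤ f →
    suc (stallerBound e) ≤ value (P n) f staller X

  pendant-dominator-lower zero X e pend E≡ E≤ with () ← trans (sym E≡) (n≤0⇒n≡0 E≤)
  pendant-dominator-lower (suc f) X e pend E≡ E≤ with best-move (P n) f dominator X
  ... | inj₁ (_ , none) = let (y , _ , one) = pendant-move X pend in ⊥-elim (none y (one⇒playable X y one))
  ... | inj₂ (y , pl , eq) with toℕ y ≤? 2
  ...   | yes y≤2 = ≤-trans (s≤s (≤-trans (dominatorBound≤stallerBound e)
      (subst (λ e → stallerBound e ≤ value (P n) f staller (insert y X)) E′≡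
        (staller-lower f (insert y X) (toℕ y) (toℕ<n y) (insert-gap X y) (≤-pred (≤-trans (playable⇒smaller X y pl) E≤))))))
      (≤-reflexive (sym eq))
    where
    E′≡ : edges (insert y X) ≡ e
    E′≡ = suc-injective (trans (sym (one⇒edges X y (pendant-hit X pend (toℕ y) y≤2))) E≡)
  ...   | no y≰2 with pendant-move (insert y X) (pendant-insert X y pend (≰⇒> y≰2))
  ...     | z , _ , one = ≤-trans (s≤s (≤-trans
      (subst (λ e → dominatorBound e ≤ suc (stallerBound e′)) e≡ (dominatorBound-≤ e′ (hits X y) (hit-≤4 (row X) (toℕ y))))
      (pendant-staller-lower f (insert y X) e′ (pendant-insert X y pend (≰⇒> y≰2)) E′≡
        (≤-pred (≤-trans (playable⇒smaller X y pl) E≤)))))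
      (≤-reflexive (sym eq))
    where
    -- The non-pendant edges left by Dominator, counted by removing the pendant one through `z`.
    e′ = edges (insert z (insert y X))
    E′≡ : edges (insert y X) ≡ suc e′
    E′≡ = one⇒edges (insert y X) z one
    e≡ : e′ + hits X y ≡ e
    e≡ = suc-injective (trans (cong (_+ hits X y) (sym E′≡)) (trans (sym (edges-insert X y)) E≡))

  pendant-staller-lower zero X e pend E≡ E≤ with () ← trans (sym E≡) (n≤0⇒n≡0 E≤)
  pendant-staller-lower (suc f) X zero pend E≡ E≤ =
    let (y , _ , one) = pendant-move X pend in ≤-trans (s≤s z≤n) (staller-≥ (P n) f X y (one⇒playable X y one))
  pendant-staller-lower (suc f) X (suc e) pend E≡ E≤ with pendant-single-hit X e pend E≡
  ... | y , 2<y , one = ≤-trans (s≤s (≤-trans (stallerBound-suc e)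
      (pendant-dominator-lower f (insert y X) e (pendant-insert X y pend 2<y) E′≡
        (≤-pred (≤-trans (≤-reflexive (sym (one⇒edges X y one))) E≤)))))
      (staller-≥ (P n) f X y (one⇒playable X y one))
    where
    E′≡ : edges (insert y X) ≡ suc e
    E′≡ = suc-injective (trans (sym (one⇒edges X y one)) E≡)

-- Opening moves on the untouched path

opaque
  unfolding edges

  edges-∅ : ∀ m → edges {suc m} ∅ ≡ m
  edges-∅ m rewrite row-0 {suc m} ∅ | row-1 {suc m} ∅ =
    trans (count-cong (3 + m) (row-∅ {m})) (count-prefix m (3 + m) (m≤n+m m 3))

  comps-∅ : ∀ m → comps {suc m} ∅ ≤ 1
  comps-∅ m rewrite row-0 {suc m} ∅ | row-1 {suc m} ∅ =
    subst (_≤ 1) (sym (runs-cong {false} (3 + m) refl (row-∅ {m}))) (initial m)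
    where
    initial : ∀ m → runs false (_<ᵇ m) (3 + m) ≤ 1
    initial zero    = z≤n
    initial (suc k) = s≤s (≤-reflexive (runs-prefix k (3 + k)))

weight-∅ : ∀ m → weight {suc m} ∅ ≤ 2 * m + 4
weight-∅ m = +-mono-≤ (2 ⊙ ≤-reflexive (edges-∅ m)) (4 ⊙ comps-∅ m)

row-∅-true : ∀ {m} i → i < m → row {suc m} ∅ (2 + i) ≡ true
row-∅-true {m} i i<m = trans (row-∅ {m} i) (Equivalence.to T-≡ (<⇒<ᵇ i<m))

-- Makes Staller's first move lower the weight by 4 instead of 2, which improves `(2n + 4) / 5` to
-- `(2n + 2) / 5`.
initial-hit : ∀ {m} → 2 ≤ m → ∀ y → y < suc m → 2 ≤ hit (row {suc m} ∅) y
initial-hit {m} 2≤m 0 _ rewrite row-∅-true {m} 0 (<⇒≤ 2≤m) | row-∅-true {m} 1 2≤m =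
  +-mono-≤ (m≤n+m 1 (bit (row {suc m} ∅ 0) + bit (row {suc m} ∅ 1))) ≤-refl
initial-hit {m} 2≤m 1 _ rewrite row-∅-true {m} 0 (<⇒≤ 2≤m) | row-∅-true {m} 1 2≤m =
  ≤-trans (+-mono-≤ (m≤n+m 1 (bit (row {suc m} ∅ 1))) ≤-refl) (m≤m+n _ _)
initial-hit {m} 2≤m (suc (suc j)) (s≤s lt) rewrite row-∅-true {m} j (<⇒≤ lt) | row-∅-true {m} (1 + j) lt =
  s≤s (s≤s z≤n)

≤-/5 : ∀ {v w} → 5 * v ≤ w → v ≤ w / 5
≤-/5 {v} {w} h = subst (_≤ w / 5) (trans (cong (_/ 5) (*-comm 5 v)) (m*n/n≡m v 5)) (/-monoˡ-≤ 5 h)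

+*5-/5 : ∀ c q → (c + q * 5) / 5 ≡ c / 5 + q
+*5-/5 c q = trans (+-distrib-/-∣ʳ c (n∣m*n q)) (cong (c / 5 +_) (m*n/n≡m q 5))

dominatorBound-+*5 : ∀ r q → dominatorBound (r + q * 5) ≡ dominatorBound r + 2 * q
dominatorBound-+*5 r zero = trans (cong dominatorBound (+-identityʳ r)) (sym (+-identityʳ _))
dominatorBound-+*5 r (suc q) = trans (cong dominatorBound (lemma₁ r q)) (trans (cong (2 +_) (dominatorBound-+*5 r q)) (lemma₂ (dominatorBound r) q))
  where
  lemma₁ : ∀ r q → r + suc q * 5 ≡ 5 + (r + q * 5)
  lemma₁ = solve-∀
  lemma₂ : ∀ d q → 2 + (d + 2 * q) ≡ d + 2 * suc q
  lemma₂ = solve-∀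

ιg-upper : ∀ m → ιg (P (suc m)) ≤ (2 * suc m + 1) / 5
ιg-upper m = ≤-/5 (≤-trans (dominator-upper (suc m) ∅)
  (≤-trans (∸-monoˡ-≤ 1 (weight-∅ m)) (≤-reflexive (trans (cong (_∸ 1) (lemma₁ m)) (lemma₂ m)))))
  where
  lemma₁ : ∀ m → 2 * m + 4 ≡ 1 + (2 * m + 3)
  lemma₁ = solve-∀
  lemma₂ : ∀ m → 2 * m + 3 ≡ 2 * suc m + 1
  lemma₂ = solve-∀

-- Here n = 5(q + 1), and the weight bound gives only 2q + 2; the single-component strategy saves
-- one move.
ιg-upper-5∣ : ∀ m q → m ≡ 4 + q * 5 → ιg (P (suc m)) ≤ 2 * q + 1
ιg-upper-5∣ m q m≡ = dominator-single (suc m) q ∅ (comps-∅ m)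
  (≤-reflexive (trans (edges-∅ m) (trans m≡ (trans (+-comm 4 (q * 5)) (cong (_+ 4) (*-comm q 5))))))

ιg-lower : ∀ m → dominatorBound m ≤ ιg (P (suc m))
ιg-lower m = subst (λ e → dominatorBound e ≤ ιg (P (suc m))) (edges-∅ m)
  (dominator-lower (suc m) ∅ (≤-trans (≤-reflexive (edges-∅ m)) (n≤1+n m)))

ιg′-upper : ∀ m → 2 ≤ m → ιg′ (P (suc m)) ≤ (2 * suc m + 2) / 5
ιg′-upper m 2≤m with best-move (P (suc m)) m staller ∅
... | inj₁ (eq , _) = ≤-trans (≤-reflexive eq) z≤n
... | inj₂ (y , _ , eq) = ≤-trans (≤-reflexive eq) (≤-/5 {suc v}
    (arith (dominator-upper m (insert y ∅))
      (≤-trans (weight-drop ∅ y 2 ≤-refl (initial-hit 2≤m (toℕ y) (toℕ<n y))) (weight-∅ m))))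
  where
  v : ℕ
  v = value (P (suc m)) m dominator (insert y ∅)
  arith : ∀ {v w′} → 5 * v ≤ w′ ∸ 1 → w′ + 4 ≤ 2 * m + 4 → 5 * suc v ≤ 2 * suc m + 2
  arith {v} {w′} h₁ h₂ with ≤-∸1 {w = w′} h₁
  ... | inj₁ h = linear 3 (h ⊹ 2 ⊙ 2≤m) (solve (v ∷ m ∷ []))
  ... | inj₂ h = linear 0 (h ⊹ h₂) (solve (v ∷ w′ ∷ m ∷ []))

-- Staller opens at an end of the path, which kills two edges, the fewest possible.
ιg′-lower : ∀ m k → m ≡ 2 + k → suc (dominatorBound k) ≤ ιg′ (P (suc m))
ιg′-lower m k m≡ = ≤-trans (s≤s (subst (λ e → dominatorBound e ≤ value (P (suc m)) m dominator (insert zero ∅)) E′≡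
    (dominator-lower m (insert zero ∅) (≤-trans (≤-reflexive E′≡) (≤-trans (m≤n+m k 2) (≤-reflexive (sym m≡)))))))
  (staller-≥ (P (suc m)) m ∅ zero (hit⇒playable ∅ zero (≤-trans (s≤s z≤n) (≤-reflexive (sym two)))))
  where
  <m : ∀ i → i < 2 → i < m
  <m i i<2 = ≤-trans i<2 (≤-trans (m≤m+n 2 k) (≤-reflexive (sym m≡)))
  two : hits {suc m} ∅ zero ≡ 2
  two rewrite row-0 {suc m} ∅ | row-1 {suc m} ∅ | row-∅-true 0 (<m 0 (s≤s z≤n)) | row-∅-true 1 (<m 1 ≤-refl) = refl
  E′≡ : edges {suc m} (insert zero ∅) ≡ k
  E′≡ = +-cancelʳ-≡ 2 _ _ (trans (cong (edges {suc m} (insert zero ∅) +_) (sym two))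
    (trans (sym (edges-insert ∅ zero)) (trans (edges-∅ m) (trans m≡ (+-comm 2 k)))))

-- Staller opens at vertex 3, killing the second to fifth edges and isolating the first. For k = 5q
-- this yields 2q + 3, whereas opening at the end yields 2q + 2.
ιg′-lower-pendant : ∀ m k → m ≡ 6 + k → 2 + dominatorBound (1 + k) ≤ ιg′ (P (suc m))
ιg′-lower-pendant m k m≡ with vertex {suc m} 3 (s≤s (≤-trans (m≤m+n 3 (3 + k)) (≤-reflexive (sym m≡)))) (_≡ 3) refl
... | y , y≡3 = ≤-trans (s≤s (pendant-dominator-lower m (insert y ∅) (1 + k) pendant E′≡
      (≤-trans (≤-reflexive E′≡) (≤-trans (m≤n+m (2 + k) 4) (≤-reflexive (sym m≡))))))
  (staller-≥ (P (suc m)) m ∅ y (hit⇒playable ∅ y (≤-trans (s≤s z≤n) (≤-reflexive (sym four)))))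
  where
  <m : ∀ i → i < 6 → i < m
  <m i i<6 = ≤-trans i<6 (≤-trans (m≤m+n 6 k) (≤-reflexive (sym m≡)))
  four : hits ∅ y ≡ 4
  four rewrite y≡3 | row-∅-true 1 (<m 1 (m≤m+n 2 4)) | row-∅-true 2 (<m 2 (m≤m+n 3 3))
    | row-∅-true 3 (<m 3 (m≤m+n 4 2)) | row-∅-true 4 (<m 4 (m≤m+n 5 1)) = refl
  E′≡ : edges (insert y ∅) ≡ 2 + k
  E′≡ = +-cancelʳ-≡ 4 _ _ (trans (cong (edges (insert y ∅) +_) (sym four))
    (trans (sym (edges-insert ∅ y)) (trans (edges-∅ m) (trans m≡ (+-comm 4 (2 + k))))))
  pendant : Pendant (insert y ∅)
  pendant = trans (Kill-outside {toℕ y} {row ∅} {row (insert y ∅)} (row-insert ∅ y) (cong (λ y → window y 2) y≡3))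
      (row-∅-true 0 (<m 0 (s≤s z≤n)))
    , subst (λ g → Gap g (insert y ∅)) y≡3 (insert-gap ∅ y)

-- Closed formulas modulo 5 and conclusion

dominator-formula : ∀ r q → r < 4 → (2 * suc (r + q * 5) + 1) / 5 ≡ dominatorBound (r + q * 5)
dominator-formula r q r<4 = trans (cong (_/ 5) (lemma r q)) (trans (+*5-/5 (2 * r + 3) (2 * q))
  (trans (cong (_+ 2 * q) (base r r<4)) (sym (dominatorBound-+*5 r q))))
  where
  lemma : ∀ r q → 2 * suc (r + q * 5) + 1 ≡ (2 * r + 3) + 2 * q * 5
  lemma = solve-∀
  base : ∀ r → r < 4 → (2 * r + 3) / 5 ≡ dominatorBound r
  base 0 _ = refl
  base 1 _ = refl
  base 2 _ = refl
  base 3 _ = refl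
  base (suc (suc (suc (suc _)))) (s≤s (s≤s (s≤s (s≤s ()))))

dominator-formula-5∣ : ∀ q → (2 * (suc q * 5) + 1) / 5 ∸ 1 ≡ 2 * q + 1
dominator-formula-5∣ q = trans (cong (_∸ 1) (trans (cong (_/ 5) (lemma q)) (+*5-/5 11 (2 * q)))) (+-comm 1 (2 * q))
  where
  lemma : ∀ q → 2 * (suc q * 5) + 1 ≡ 11 + 2 * q * 5
  lemma = solve-∀

-- Residues are those of n - 3, the number of edges left when Staller opens at the end.
staller-formula : ∀ r q → (2 * (3 + (r + q * 5)) + 2) / 5 ≡ (2 * r + 8) / 5 + 2 * q
staller-formula r q = trans (cong (_/ 5) (lemma r q)) (+*5-/5 (2 * r + 8) (2 * q))
  where
  lemma : ∀ r q → 2 * (3 + (r + q * 5)) + 2 ≡ (2 * r + 8) + 2 * q * 5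
  lemma = solve-∀

ιg′-lower-formula : ∀ m r q → r < 5 → m ≡ 2 + (r + q * 5) → (2 * r + 8) / 5 + 2 * q ≤ ιg′ (P (suc m))
ιg′-lower-formula m 0 q _ m≡ = subst (λ d → 1 + d ≤ ιg′ (P (suc m))) (dominatorBound-+*5 0 q) (ιg′-lower m _ m≡)
ιg′-lower-formula m 1 q _ m≡ = subst (λ d → 1 + d ≤ ιg′ (P (suc m))) (dominatorBound-+*5 1 q) (ιg′-lower m _ m≡)
ιg′-lower-formula m 2 q _ m≡ = subst (λ d → 1 + d ≤ ιg′ (P (suc m))) (dominatorBound-+*5 2 q) (ιg′-lower m _ m≡)
ιg′-lower-formula m 3 q _ m≡ = subst (λ d → 1 + d ≤ ιg′ (P (suc m))) (dominatorBound-+*5 3 q) (ιg′-lower m _ m≡)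
-- This is n ≡ 2 modulo 5, where opening at the end falls one short.
ιg′-lower-formula m 4 q _ m≡ = subst (λ d → 2 + d ≤ ιg′ (P (suc m))) (dominatorBound-+*5 1 q) (ιg′-lower-pendant m _ m≡)
ιg′-lower-formula m (suc (suc (suc (suc (suc _))))) q (s≤s (s≤s (s≤s (s≤s (s≤s ()))))) m≡

ιg-path-5∣ : ∀ n q → n ≥ 1 → n ≡ q * 5 → ιg (P n) ≡ (2 * n + 1) / 5 ∸ 1
ιg-path-5∣ (suc m) (suc q) _ n≡ = trans (≤-antisym (ιg-upper-5∣ m q m≡) lower)
  (sym (trans (cong (λ n → (2 * n + 1) / 5 ∸ 1) n≡) (dominator-formula-5∣ q)))
  where
  m≡ : m ≡ 4 + q * 5
  m≡ = suc-injective n≡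
  lower : 2 * q + 1 ≤ ιg (P (suc m))
  lower = subst (_≤ ιg (P (suc m))) (trans (cong dominatorBound m≡) (trans (dominatorBound-+*5 4 q) (+-comm 1 (2 * q))))
    (ιg-lower m)

ιg-path-5∤ : ∀ n r q → r < 5 → r ≢ 0 → n ≡ r + q * 5 → ιg (P n) ≡ (2 * n + 1) / 5
ιg-path-5∤ _       zero    q r<5       r≢0 _  = ⊥-elim (r≢0 refl)
ιg-path-5∤ (suc m) (suc r) q (s≤s r<4) _   n≡ = ≤-antisym (ιg-upper m)
  (subst (λ k → (2 * suc k + 1) / 5 ≤ ιg (P (suc m))) (sym m≡)
    (subst (_≤ ιg (P (suc m))) (trans (cong dominatorBound m≡) (sym (dominator-formula r q r<4))) (ιg-lower m)))
  where
  m≡ : m ≡ r + q * 5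
  m≡ = suc-injective n≡

ιg′-path : ∀ n → n ≥ 1 → ιg′ (P n) ≡ (2 * n + 2) / 5
-- With at most one edge no opening kills two, so these two paths are evaluated directly.
ιg′-path 1 _ = refl
ιg′-path 2 _ = refl
ιg′-path (suc m@(suc (suc k))) _ = ≤-antisym (ιg′-upper m (s≤s (s≤s z≤n))) (lower m refl)
  where
  k≡ : k ≡ k % 5 + k / 5 * 5
  k≡ = m≡m%n+[m/n]*n k 5
  lower : ∀ m → m ≡ 2 + k → (2 * suc (2 + k) + 2) / 5 ≤ ιg′ (P (suc m))
  lower m m≡ = ≤-trans
    (≤-reflexive (trans (cong (λ k → (2 * (3 + k) + 2) / 5) k≡) (staller-formula (k % 5) (k / 5))))
    (ιg′-lower-formula m (k % 5) (k / 5) (m%n<n k 5) (trans m≡ (cong (2 +_) k≡)))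

theorem2p5 : (n : ℕ) → n ≥ 1 →
    ((n % 5 ≡ 0 → ιg (P n) ≡ (2 * n + 1) / 5 ∸ 1) ×
    (n % 5 ≢ 0 → ιg (P n) ≡ (2 * n + 1) / 5)) ×
    ιg′ (P n) ≡ (2 * n + 2) / 5
theorem2p5 n n≥1 =
  ( (λ n%5≡0 → ιg-path-5∣ n (n / 5) n≥1 (trans (m≡m%n+[m/n]*n n 5) (cong (_+ n / 5 * 5) n%5≡0)))
  , (λ n%5≢0 → ιg-path-5∤ n (n % 5) (n / 5) (m%n<n n 5) n%5≢0 (m≡m%n+[m/n]*n n 5)))
  , ιg′-path n n≥1
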